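{- Let $G$ be a finite pruned graph. Then $\mathrm{cat}(G)=2$ if and only if $G\cong C_3$, $G\cong P_3$, or $G\cong P_4$.
   Context: Cat Herding is played on a simple graph $G$. The cat first places its token on a vertex. Then the players alternate, the herder moving first: the herder deletes one edge of the current graph, and then, unless the cat's current vertex has degree $0$ in the current graph, the cat moves its token along a path with at least one edge in the current graph to a different vertex. The cat is captured when its vertex has degree $0$ in the current graph, and the game ends; the score is the number of edges deleted. For a finite graph $G$ and $v\in V(G)$, $\mathrm{cat}(G,v)$ is the score under optimal play (herder minimizing, cat maximizing) when the cat starts at $v$, and $\mathrm{cat}(G)=\max_{v}\mathrm{cat}(G,v)$. $P_n$ denotes the path on $n$ vertices and $C_n$ the cycle on $n$ vertices. A pruned graph is a connected graph containing no configuration $x\sim y\sim z$ with $x\neq z$, $\deg(x)=\deg(z)=1$ and $\deg(y)\ge 3$ (i.e. every vertex of degree at least $3$ is adjacent to at most one leaf). -}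

module Defs where

open import Data.Bool.Base using (if_then_else_)
open import Data.Fin.Base as Fin using (Fin; toℕ)
open import Data.Fin.Properties as Fin using (_≟_; _<?_)
open import Data.List.Base using (List; []; _∷_; length; map; filter; allFin; cartesianProduct)
open import Data.List.Extrema.Nat using (min; max)
open import Data.List.Membership.Propositional using (_∈_)
open import Data.List.Membership.Propositional.Properties using (∈-allFin)
open import Data.List.Relation.Unary.Any using (here; there)
open import Data.Nat.Base using (ℕ; zero; suc; _≤_; s≤s; _≥_)
open import Data.Nat.Properties as ℕ using (_≤?_; 1+n≢n)
open import Data.Product.Base using (Σ; ∃; _×_; _,_)
open import Data.Sum.Base using (_⊎_; inj₁; inj₂; swap)
open import Function.Base using (_∘_)
open import Function.Bundles using (_↔_; _⇔_; Inverse)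
open import Level using (0ℓ)
open import Relation.Binary.Core using (Rel)
open import Relation.Binary.Construct.Closure.ReflexiveTransitive using (Star; ε; _◅_; _◅◅_)
open import Relation.Binary.Definitions using (Decidable; Symmetric)
open import Relation.Binary.PropositionalEquality using (_≡_; _≢_; refl; sym; trans; cong; subst)
open import Relation.Nullary.Decidable using (Dec; does; True; toWitness; map′; _×-dec_; _⊎-dec_; ¬?)
open import Relation.Nullary.Negation using (¬_)

record Graph (n : ℕ) : Set₁ where
  field
    Adj     : Rel (Fin n) 0ℓ
    adj?    : Decidable Adj
    adj-sym : Symmetric Adj
    irrefl  : ∀ {v} → ¬ Adj v v

open Graph public

private
  variable
    m n : ℕ

deg : Graph n → Fin n → ℕ
deg G v = length (filter (adj? G v) (allFin _))

-- Each edge {i , j} is listed once, as the pair with i < j.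
edges : Graph n → List (Fin n × Fin n)
edges G = filter (λ (i , j) → (i Fin.<? j) ×-dec adj? G i j)
                 (cartesianProduct (allFin _) (allFin _))

-- Equality of the unordered pairs {x , y} and {a , b}.
SamePair : Fin n × Fin n → Fin n × Fin n → Set
SamePair (x , y) (a , b) = (x ≡ a × y ≡ b) ⊎ (x ≡ b × y ≡ a)

samePair? : (p q : Fin n × Fin n) → Dec (SamePair p q)
samePair? (x , y) (a , b) =
  ((x Fin.≟ a) ×-dec (y Fin.≟ b)) ⊎-dec ((x Fin.≟ b) ×-dec (y Fin.≟ a))

samePair-swap : {x y : Fin n} {e : Fin n × Fin n} → SamePair (y , x) e → SamePair (x , y) e
samePair-swap (inj₁ (p , q)) = inj₂ (q , p)
samePair-swap (inj₂ (p , q)) = inj₁ (q , p)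

infixl 6 _-ᵉ_

_-ᵉ_ : Graph n → Fin n × Fin n → Graph n
(G -ᵉ e) .Adj x y         = Adj G x y × ¬ SamePair (x , y) e
(G -ᵉ e) .adj? x y        = adj? G x y ×-dec ¬? (samePair? (x , y) e)
(G -ᵉ e) .adj-sym (a , d) = adj-sym G a , d ∘ samePair-swap
(G -ᵉ e) .irrefl (a , _)  = irrefl G a

-- There is a walk, equivalently a path, from x to y.  Between different
-- vertices such a path has at least one edge.
Reachable : Graph n → Rel (Fin n) 0ℓ
Reachable G = Star (Adj G)

-- Warshall's algorithm: Via G us x y holds when y is reached from x with all
-- inner vertices taken from us.
Via : Graph n → List (Fin n) → Rel (Fin n) 0ℓ
Via G []       x y = x ≡ y ⊎ Adj G x y
Via G (u ∷ us) x y = Via G us x y ⊎ (Via G us x u × Via G us u y)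

via? : (G : Graph n) (us : List (Fin n)) → Decidable (Via G us)
via? G []       x y = (x Fin.≟ y) ⊎-dec adj? G x y
via? G (u ∷ us) x y = via? G us x y ⊎-dec (via? G us x u ×-dec via? G us u y)

via⇒reachable : (G : Graph n) (us : List (Fin n)) {x y : Fin n} → Via G us x y → Reachable G x y
via⇒reachable G []       (inj₁ refl)    = ε
via⇒reachable G []       (inj₂ a)       = a ◅ ε
via⇒reachable G (u ∷ us) (inj₁ p)       = via⇒reachable G us p
via⇒reachable G (u ∷ us) (inj₂ (p , q)) = via⇒reachable G us p ◅◅ via⇒reachable G us q

via-base : (G : Graph n) (us : List (Fin n)) {x y : Fin n} → x ≡ y ⊎ Adj G x y → Via G us x y
via-base G []       p = p
via-base G (u ∷ us) p = inj₁ (via-base G us p)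

via-trans : (G : Graph n) (us : List (Fin n)) {x y z : Fin n} →
            z ∈ us → Via G us x z → Via G us z y → Via G us x y
via-trans {n} G (u ∷ us) {x} {y} (here refl) p q = inj₂ (into p , out q)
  where
  into : Via G (u ∷ us) x u → Via G us x u
  into (inj₁ r)       = r
  into (inj₂ (r , _)) = r
  out : Via G (u ∷ us) u y → Via G us u y
  out (inj₁ r)       = r
  out (inj₂ (_ , r)) = r
via-trans G (u ∷ us) (there z∈) (inj₁ p)       (inj₁ q)       = inj₁ (via-trans G us z∈ p q)
via-trans G (u ∷ us) (there z∈) (inj₁ p)       (inj₂ (q , r)) = inj₂ (via-trans G us z∈ p q , r)
via-trans G (u ∷ us) (there z∈) (inj₂ (p , q)) (inj₁ r)       = inj₂ (p , via-trans G us z∈ q r)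
via-trans G (u ∷ us) (there z∈) (inj₂ (p , q)) (inj₂ (r , s)) = inj₂ (p , s)

reachable⇒via : (G : Graph n) {x y : Fin n} → Reachable G x y → Via G (allFin n) x y
reachable⇒via {n} G ε       = via-base G (allFin n) (inj₁ refl)
reachable⇒via {n} G (a ◅ p) =
  via-trans G (allFin n) (∈-allFin _) (via-base G (allFin n) (inj₂ a)) (reachable⇒via G p)

reachable? : (G : Graph n) → Decidable (Reachable G)
reachable? {n} G x y = map′ (via⇒reachable G (allFin n)) (reachable⇒via G) (via? G (allFin n) x y)

moves : Graph n → Fin n → List (Fin n)
moves G v = filter (λ w → ¬? (w Fin.≟ v) ×-dec reachable? G v w) (allFin _)

minimum : List ℕ → ℕ
minimum []       = 0      -- not used: the herder always has an edge to delete
minimum (x ∷ xs) = min x xs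

maximum : List ℕ → ℕ
maximum = max 0

-- Minimax value: herderToMove k G v (catToMove k G v) is the number of further
-- deletions under optimal play when the current graph is G, the cat is on v and
-- the herder (the cat) is next.  The recursion is on a bound k for the number
-- of edges of G.  Each deletion removes one edge, so if the bound holds at the
-- start it holds throughout, and at k = 0 the cat has degree 0: the first
-- clause is then a capture, not a truncation of the game.
mutual
  herderToMove : ℕ → Graph n → Fin n → ℕ
  herderToMove zero    G v = 0
  herderToMove (suc k) G v =
    if does (deg G v ℕ.≟ 0) then 0
    else suc (minimum (map (λ e → catToMove k (G -ᵉ e) v) (edges G)))

  catToMove : ℕ → Graph n → Fin n → ℕ
  catToMove k G v =
    if does (deg G v ℕ.≟ 0) then 0
    else maximum (map (herderToMove k G) (moves G v))

catFrom : Graph n → Fin n → ℕ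
catFrom G v = herderToMove (length (edges G)) G v

cat : Graph n → ℕ
cat G = maximum (map (catFrom G) (allFin _))

Connected : Graph n → Set
Connected {n} G = Fin n × (∀ x y → Reachable G x y)

Pruned : Graph n → Set
Pruned {n} G =
  Connected G ×
  ¬ (∃ λ (x : Fin n) → ∃ λ (y : Fin n) → ∃ λ (z : Fin n) →
       Adj G x y × Adj G y z × x ≢ z × deg G x ≡ 1 × deg G z ≡ 1 × deg G y ≥ 3)

infix 4 _≅_

_≅_ : Graph m → Graph n → Set
_≅_ {m} {n} G H =
  Σ (Fin m ↔ Fin n) λ f → ∀ x y → Adj G x y ⇔ Adj H (Inverse.to f x) (Inverse.to f y)

P : (n : ℕ) → Graph n
P n .Adj i j     = suc (toℕ i) ≡ toℕ j ⊎ suc (toℕ j) ≡ toℕ i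
P n .adj? i j    = (suc (toℕ i) ℕ.≟ toℕ j) ⊎-dec (suc (toℕ j) ℕ.≟ toℕ i)
P n .adj-sym     = swap
P n .irrefl (inj₁ p) = 1+n≢n p
P n .irrefl (inj₂ p) = 1+n≢n p

-- j is the cyclic successor of i in 0 , 1 , … , n - 1.
Next : Fin n → Fin n → Set
Next {n} i j = suc (toℕ i) ≡ toℕ j ⊎ (suc (toℕ i) ≡ n × toℕ j ≡ 0)

next? : (i j : Fin n) → Dec (Next i j)
next? {n} i j = (suc (toℕ i) ℕ.≟ toℕ j) ⊎-dec ((suc (toℕ i) ℕ.≟ n) ×-dec (toℕ j ℕ.≟ 0))

next-irrefl : 3 ≤ n → {i : Fin n} → ¬ Next i i
next-irrefl 3≤n (inj₁ p) = 1+n≢n p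
next-irrefl 3≤n (inj₂ (p , q)) with subst (3 ≤_) (trans (sym p) (cong suc q)) 3≤n
... | s≤s ()

C : (n : ℕ) → {True (3 ≤? n)} → Graph n
C n .Adj i j  = Next i j ⊎ Next j i
C n .adj? i j = next? i j ⊎-dec next? j i
C n .adj-sym  = swap
C n {3≤n} .irrefl (inj₁ p) = next-irrefl (toWitness 3≤n) p
C n {3≤n} .irrefl (inj₂ p) = next-irrefl (toWitness 3≤n) p

{-# OPTIONS --safe #-}
-- Capturing the cat with one more deletion is possible exactly when its vertex
-- has degree at most 1.  Hence the herder wins from v with two deletions iff
-- some edge can be deleted so that the component of v becomes a star centred
-- at v.  If this holds everywhere in a pruned graph, then all degrees are at
-- most 2: of three neighbours of v, those off the deleted edge are leaves, so
-- two of them are the ends of that edge, and then the condition fails at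
-- either end.  Applying the condition at a vertex of degree 2, and at a
-- neighbour of it, leaves only C₃, P₃ and P₄.
module Submission where

open import Defs
open import Data.Empty using (⊥; ⊥-elim)
open import Data.Fin.Base using (Fin; zero; suc; toℕ)
open import Data.Fin.Properties as Fin using (any?; injective⇒≤)
open import Data.List.Base as List using (List; []; _∷_; length; map; allFin; filter; cartesianProduct)
open import Data.List.Extrema.Nat using (argmin-sel; min≤xs; min≤⊤; max≤v⁺; xs≤max)
open import Data.List.Membership.Propositional using (_∈_)
open import Data.List.Membership.Propositional.Properties
  using (∈-map⁺; ∈-map⁻; ∈-filter⁺; ∈-filter⁻; ∈-allFin; ∈-cartesianProduct⁺)
open import Data.List.Properties using (filter-none)
open import Data.List.Relation.Binary.Pointwise using (Pointwise-≡⇒≡)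
open import Data.List.Relation.Binary.Sublist.Propositional using (_⊆_; ⊆-refl)
open import Data.List.Relation.Binary.Sublist.Propositional.Properties
  using (filter⁺; length-mono-≤; to-≋)
import Data.List.Relation.Unary.All as All
open import Data.List.Relation.Unary.Any using (here; there; index)
open import Data.List.Relation.Unary.Any.Properties using (lookup-index)
import Data.List.Relation.Unary.AllPairs as ListPairs
import Data.List.Relation.Unary.Unique.Propositional as ListUnique
import Data.List.Relation.Unary.Unique.Propositional.Properties as ListUnique
open import Data.Nat.Base using (ℕ; zero; suc; _≤_; _<_; z≤n; s≤s)
open import Data.Nat.Properties
  using (≤-trans; ≤-refl; ≤-reflexive; ≤-antisym; ≤∧≢⇒<)
open import Data.Product.Base using (∃; ∃₂; _×_; _,_; proj₁; proj₂)
open import Data.Sum.Base using (_⊎_; inj₁; inj₂; [_,_]; swap)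
open import Data.Vec.Base using (Vec; []; _∷_; lookup)
open import Data.Vec.Relation.Unary.All as VecAll using ([]; _∷_)
import Data.Vec.Relation.Unary.All.Properties as AllProps
open import Data.Vec.Relation.Unary.AllPairs using ([]; _∷_)
open import Data.Vec.Relation.Unary.Unique.Propositional using (Unique)
open import Data.Vec.Relation.Unary.Unique.Propositional.Properties using (lookup-injective)
open import Function.Base using (_∘_; id)
open import Function.Bundles using (_⇔_; Equivalence; Inverse; mk⇔; mk↔ₛ′)
open import Relation.Binary.Construct.Closure.ReflexiveTransitive using (ε; _◅_)
open import Relation.Binary.Definitions using (tri<; tri≈; tri>)
open import Relation.Binary.PropositionalEquality
  using (_≡_; _≢_; refl; sym; trans; cong; subst; subst₂)
open import Relation.Nullary.Decidable using (yes; no; ¬?; _×-dec_; decidable-stable)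
open import Relation.Nullary.Negation using (¬_; contradiction)

private
  variable
    m n k b : ℕ
    A : Set

-- Lists

minimum-map-≤ : (f : A → ℕ) {x : A} {xs : List A} → x ∈ xs → minimum (map f xs) ≤ f x
minimum-map-≤ f {xs = y ∷ ys} (here refl) = min≤⊤ (f y) (map f ys)
minimum-map-≤ f {xs = y ∷ ys} (there x∈)  =
  All.lookup (min≤xs (f y) (map f ys)) (∈-map⁺ f x∈)

-- The membership hypothesis excludes the empty list, on which `minimum` is a default 0 that `f`
-- need not attain.
minimum-map-attained : (f : A → ℕ) {x : A} {xs : List A} → x ∈ xs →
                       ∃ λ y → y ∈ xs × minimum (map f xs) ≡ f y
minimum-map-attained f {xs = y ∷ ys} _ with argmin-sel id (f y) (map f ys)
... | inj₁ eq = y , here refl , eq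
... | inj₂ m∈ with z , z∈ , eq ← ∈-map⁻ f m∈ = z , there z∈ , eq

maximum-map-≤ : (f : A → ℕ) (xs : List A) → (∀ {x} → x ∈ xs → f x ≤ b) → maximum (map f xs) ≤ b
maximum-map-≤ {b = b} f xs f≤b = max≤v⁺ z≤n (All.tabulate λ y∈ → bound (∈-map⁻ f y∈))
  where
  bound : ∀ {y} → (∃ λ x → x ∈ xs × y ≡ f x) → y ≤ b
  bound (x , x∈ , refl) = f≤b x∈

≤-maximum-map : (f : A → ℕ) {x : A} {xs : List A} → x ∈ xs → f x ≤ maximum (map f xs)
≤-maximum-map f {xs = xs} x∈ = All.lookup (xs≤max 0 (map f xs)) (∈-map⁺ f x∈)

unique-constant⇒length≤1 : {a : A} {xs : List A} → ListUnique.Unique xs → (∀ {x} → x ∈ xs → x ≡ a) →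
                           length xs ≤ 1
unique-constant⇒length≤1 {xs = []}         _ _ = z≤n
unique-constant⇒length≤1 {xs = _ ∷ []}     _ _ = s≤s z≤n
unique-constant⇒length≤1 {xs = _ ∷ _ ∷ _} ((x≢y All.∷ _) ListPairs.∷ _) const =
  contradiction (trans (const (here refl)) (sym (const (there (here refl))))) x≢y

-- Degrees and edges

module _ (G : Graph n) where

  -- Sending each entry of `xs` to its position in the list of neighbours is an injection from
  -- `Fin k` into `Fin (deg G v)`.
  distinct-neighbours⇒≤deg : {v : Fin n} (xs : Vec (Fin n) k) → Unique xs →
                             VecAll.All (Adj G v) xs → k ≤ deg G v
  distinct-neighbours⇒≤deg {v = v} xs unique adj = injective⇒≤ position-injective
    where
    listed : ∀ i → lookup xs i ∈ filter (adj? G v) (allFin n)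
    listed i = ∈-filter⁺ (adj? G v) (∈-allFin _) (AllProps.lookup⁺ adj i)

    position-injective : ∀ {i j} → index (listed i) ≡ index (listed j) → i ≡ j
    position-injective {i} {j} eq = lookup-injective unique i j
      (trans (lookup-index (listed i))
        (trans (cong (List.lookup (filter (adj? G v) (allFin n))) eq)
          (sym (lookup-index (listed j)))))

  isolated⇒deg≡0 : {v : Fin n} → (∀ {a} → ¬ Adj G v a) → deg G v ≡ 0
  isolated⇒deg≡0 ¬adj = cong length (filter-none (adj? G _) {xs = allFin n} (All.tabulate λ _ → ¬adj))

  adj⇒1≤deg : {v a : Fin n} → Adj G v a → 1 ≤ deg G v
  adj⇒1≤deg va = distinct-neighbours⇒≤deg (_ ∷ []) ([] ∷ []) (va ∷ [])

  leaf⇒deg≡1 : {v a : Fin n} → Adj G v a → (∀ {x} → Adj G v x → x ≡ a) → deg G v ≡ 1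
  leaf⇒deg≡1 {v} va only = ≤-antisym
    (unique-constant⇒length≤1 (ListUnique.filter⁺ (adj? G v) (ListUnique.allFin⁺ n))
      (only ∘ proj₂ ∘ ∈-filter⁻ (adj? G v) {xs = allFin n}))
    (adj⇒1≤deg va)

  adj⇒≢ : {x y : Fin n} → Adj G x y → x ≢ y
  adj⇒≢ xy refl = irrefl G xy

  private
    listed? : (e : Fin n × Fin n) → _
    listed? (i , j) = (i Fin.<? j) ×-dec adj? G i j

  ∈-edges⁻ : {p q : Fin n} → (p , q) ∈ edges G → Adj G p q
  ∈-edges⁻ e∈ = proj₂ (proj₂ (∈-filter⁻ listed? {xs = cartesianProduct (allFin n) (allFin n)} e∈))

  ∈-edges⁺ : {p q : Fin n} → Adj G p q → (p , q) ∈ edges G ⊎ (q , p) ∈ edges G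
  ∈-edges⁺ {p} {q} pq with Fin.<-cmp p q
  ... | tri< p<q _ _ = inj₁ (∈-filter⁺ listed? (∈-cartesianProduct⁺ (∈-allFin p) (∈-allFin q)) (p<q , pq))
  ... | tri≈ _ p≡q _ = contradiction p≡q (adj⇒≢ pq)
  ... | tri> _ _ q<p = inj₂ (∈-filter⁺ listed? (∈-cartesianProduct⁺ (∈-allFin q) (∈-allFin p)) (q<p , adj-sym G pq))

  -- The new edge list is a sublist of the old one. With equal lengths the two would coincide, and
  -- `e` would survive its own deletion.
  edges-decrease : {e : Fin n × Fin n} → e ∈ edges G → length (edges (G -ᵉ e)) < length (edges G)
  edges-decrease {e} e∈ = ≤∧≢⇒< (length-mono-≤ fewer) λ eq →
    proj₂ (proj₂ (proj₂ (∈-filter⁻ remaining? {xs = cartesianProduct (allFin n) (allFin n)}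
      (subst (e ∈_) (sym (Pointwise-≡⇒≡ (to-≋ eq fewer))) e∈))))
      (inj₁ (refl , refl))
    where
    remaining? : (d : Fin n × Fin n) → _
    remaining? (i , j) = (i Fin.<? j) ×-dec adj? (G -ᵉ e) i j

    fewer : edges (G -ᵉ e) ⊆ edges G
    fewer = filter⁺ remaining? listed? (λ { refl (i<j , ij , _) → i<j , ij })
              (⊆-refl {x = cartesianProduct (allFin n) (allFin n)})

-- One deletion destroys at most one of two different edges at `v`; this is what lets the cat
-- survive it in `2≤herder`.
samePair-cancel : {v x y : Fin n} {e : Fin n × Fin n} →
                  SamePair (v , x) e → SamePair (v , y) e → x ≡ y
samePair-cancel (inj₁ (_ , refl))    (inj₁ (_ , refl))    = refl
samePair-cancel (inj₁ (refl , refl)) (inj₂ (refl , refl)) = refl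
samePair-cancel (inj₂ (refl , refl)) (inj₁ (refl , refl)) = refl
samePair-cancel (inj₂ (_ , refl))    (inj₂ (_ , refl))    = refl

-- The last rounds of the game

Pendant : Graph n → Fin n → Set
Pendant G v = ∀ {x y} → Adj G v x → Adj G v y → x ≡ y

-- The component of v is a star with centre v, possibly v alone.
StarAt : Graph n → Fin n → Set
StarAt G v = ∀ {a x} → Adj G v a → Adj G a x → x ≡ v

-- Asking for `Adj G p q` instead of membership in `edges G` leaves the order of the ends free, so
-- that a cut can be moved along an isomorphism.
Cut : Graph n → Fin n → Set
Cut G v = ∃₂ λ p q → Adj G p q × StarAt (G -ᵉ (p , q)) v

Cherry : Graph n → Set
Cherry G = ∃ λ v → ∃₂ λ a b → Adj G v a × Adj G v b × a ≢ b

module _ (G : Graph n) {v : Fin n} where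

  catToMove-≤ : (∀ {w} → w ≢ v → Reachable G v w → herderToMove k G w ≤ b) → catToMove k G v ≤ b
  catToMove-≤ {k} bound with deg G v
  ... | zero  = z≤n
  ... | suc _ = maximum-map-≤ (herderToMove k G) (moves G v) λ w∈ →
    let w≢v , path = proj₂ (∈-filter⁻ (λ w → ¬? (w Fin.≟ v) ×-dec reachable? G v w) {xs = allFin n} w∈)
    in bound w≢v path

  -- Moves along a single edge suffice for all lower bounds on the score.
  ≤-catToMove : {w : Fin n} → Adj G v w → herderToMove k G w ≤ catToMove k G v
  ≤-catToMove {k} {w} vw with deg G v | adj⇒1≤deg G vw
  ... | suc _ | _ = ≤-maximum-map (herderToMove k G)
    (∈-filter⁺ (λ w → ¬? (w Fin.≟ v) ×-dec reachable? G v w) (∈-allFin w)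
      (adj⇒≢ G (adj-sym G vw) , vw ◅ ε))

  herderToMove-isolated : (∀ {a} → ¬ Adj G v a) → herderToMove k G v ≡ 0
  herderToMove-isolated {zero}  _ = refl
  herderToMove-isolated {suc k} ¬adj with deg G v | isolated⇒deg≡0 G ¬adj
  ... | zero | _ = refl

  catToMove-isolated : (∀ {a} → ¬ Adj G v a) → catToMove k G v ≤ 0
  catToMove-isolated {k} ¬adj = catToMove-≤ {k} λ where
    w≢v ε       → contradiction refl w≢v
    w≢v (a ◅ _) → contradiction a ¬adj

  herderToMove-≤ : {e : Fin n × Fin n} → e ∈ edges G →
                   herderToMove (suc k) G v ≤ suc (catToMove k (G -ᵉ e) v)
  herderToMove-≤ {k} e∈ with deg G v
  ... | zero  = z≤n
  ... | suc _ = s≤s (minimum-map-≤ (λ e → catToMove k (G -ᵉ e) v) e∈)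

  -- Lower bounds must exclude a truncated game. Since a deletion strictly shortens the edge list,
  -- `length (edges G) ≤ k` rules out `k = 0` while an edge is left, and `j` inherits the bound for
  -- the next round.
  herderToMove-attained : {a : Fin n} → Adj G v a → length (edges G) ≤ k →
    ∃₂ λ j e → e ∈ edges G × length (edges (G -ᵉ e)) ≤ j ×
               herderToMove k G v ≡ suc (catToMove j (G -ᵉ e) v)
  herderToMove-attained {k} {a} va bound = attained k bound (proj₂ some-edge)
    where
    some-edge : ∃ λ e → e ∈ edges G
    some-edge = [ _ ,_ , _ ,_ ] (∈-edges⁺ G va)

    attained : ∀ k → length (edges G) ≤ k → {e : Fin n × Fin n} → e ∈ edges G →
      ∃₂ λ j e → e ∈ edges G × length (edges (G -ᵉ e)) ≤ j ×
                 herderToMove k G v ≡ suc (catToMove j (G -ᵉ e) v)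
    attained zero bound e∈ with () ← ≤-trans (edges-decrease G e∈) bound
    attained (suc j) bound e∈ with deg G v | adj⇒1≤deg G va
    ... | suc _ | _
      with d , d∈ , eq ← minimum-map-attained (λ e → catToMove j (G -ᵉ e) v) e∈
      with s≤s bound′ ← ≤-trans (edges-decrease G d∈) bound
      = j , d , d∈ , bound′ , cong suc eq

module _ (G : Graph n) where

  some-neighbour : (v : Fin n) → (∃ λ a → Adj G v a) ⊎ (∀ {a} → ¬ Adj G v a)
  some-neighbour v with any? (adj? G v)
  ... | yes neighbour = inj₁ neighbour
  ... | no  none      = inj₂ λ va → none (_ , va)

  -- The edge may be listed as (q , p), so the bound is asked of any deletion that
  -- leaves no more than the deletion of (p , q) does.
  herder-by-edge : {p q v : Fin n} → Adj G p q →
                   (∀ e j → (∀ {x y} → Adj (G -ᵉ e) x y → Adj (G -ᵉ (p , q)) x y) →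
                            catToMove j (G -ᵉ e) v ≤ b) →
                   herderToMove k G v ≤ suc b
  herder-by-edge {k = zero}  pq bound = z≤n
  herder-by-edge {k = suc k} {p} {q} pq bound with ∈-edges⁺ G pq
  ... | inj₁ e∈ = ≤-trans (herderToMove-≤ G {k = k} e∈) (s≤s (bound (p , q) k id))
  ... | inj₂ e∈ = ≤-trans (herderToMove-≤ G {k = k} e∈) (s≤s (bound (q , p) k λ (xy , ¬e) → xy , ¬e ∘ swap))

  -- The herder deletes the only edge at `v`, if there is one.
  pendant⇒herder≤1 : {v : Fin n} → Pendant G v → herderToMove k G v ≤ 1
  pendant⇒herder≤1 {k = k} {v} pendant with some-neighbour v
  ... | inj₂ none = ≤-trans (≤-reflexive (herderToMove-isolated G {k = k} none)) z≤n
  ... | inj₁ (a , va) = herder-by-edge {k = k} va λ e j keep →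
    catToMove-isolated (G -ᵉ e) {k = j} λ vx →
      let vx′ , ¬va = keep vx in ¬va (inj₁ (refl , pendant vx′ va))

  star-reachable : {v w : Fin n} → StarAt G v → Reachable G v w → w ≡ v ⊎ Adj G v w
  star-reachable star ε            = inj₁ refl
  star-reachable star (va ◅ ε)     = inj₂ va
  star-reachable star (va ◅ ax ◅ p) with refl ← star va ax = star-reachable star p

  -- A cat at the centre has to leave it, and every other vertex it can reach is a leaf.
  star⇒cat≤1 : {v : Fin n} → StarAt G v → catToMove k G v ≤ 1
  star⇒cat≤1 {k} {v} star = catToMove-≤ G {k = k} λ w≢v path → at-leaf w≢v (star-reachable star path)
    where
    at-leaf : ∀ {w} → w ≢ v → w ≡ v ⊎ Adj G v w → herderToMove k G w ≤ 1
    at-leaf w≢v (inj₁ w≡v) = contradiction w≡v w≢v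
    at-leaf _   (inj₂ vw)  = pendant⇒herder≤1 {k = k} λ wx wy → trans (star vw wx) (sym (star vw wy))

cut⇒herder≤2 : (G : Graph n) {v : Fin n} → Cut G v → herderToMove k G v ≤ 2
cut⇒herder≤2 {k = k} G (p , q , pq , star) = herder-by-edge G {k = k} pq λ e j keep →
  star⇒cat≤1 (G -ᵉ e) {k = j} λ va ax → star (keep va) (keep ax)

-- Lower bounds on the score

1≤herder : (G : Graph n) {v a : Fin n} → Adj G v a → length (edges G) ≤ k → 1 ≤ herderToMove k G v
1≤herder G va bound with _ , _ , _ , _ , eq ← herderToMove-attained G va bound =
  ≤-trans (s≤s z≤n) (≤-reflexive (sym eq))

1≤cat : (G : Graph n) {v a : Fin n} → Adj G v a → length (edges G) ≤ k → 1 ≤ catToMove k G v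
1≤cat {k = k} G va bound = ≤-trans (1≤herder G (adj-sym G va) bound) (≤-catToMove G {k = k} va)

-- Whichever edge is deleted first, `v` keeps one of the edges to `x` and `y`; the cat moves along
-- it and costs one more deletion.
2≤herder : (G : Graph n) {v x y : Fin n} → Adj G v x → Adj G v y → x ≢ y →
           length (edges G) ≤ k → 2 ≤ herderToMove k G v
2≤herder G {v} {x} {y} vx vy x≢y bound
  with j , e , _ , bound′ , eq ← herderToMove-attained G vx bound =
  ≤-trans (s≤s remaining) (≤-reflexive (sym eq))
  where
  remaining : 1 ≤ catToMove j (G -ᵉ e) v
  remaining with samePair? (v , x) e
  ... | no  vx≢e = 1≤cat (G -ᵉ e) (vx , vx≢e) bound′
  ... | yes vx≡e = 1≤cat (G -ᵉ e) (vy , λ vy≡e → x≢y (samePair-cancel vx≡e vy≡e)) bound′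

-- If a neighbour `a` of `v` had a neighbour `x` other than `v`, the cat could move to `a`, which
-- then has two neighbours and costs two deletions.
cat≤1⇒star : (G : Graph n) {v : Fin n} → length (edges G) ≤ k → catToMove k G v ≤ 1 → StarAt G v
cat≤1⇒star {k = k} G {v} bound cat≤1 {a} {x} va ax with x Fin.≟ v
... | yes x≡v = x≡v
... | no  x≢v with s≤s () ← ≤-trans (2≤herder G ax (adj-sym G va) x≢v bound)
                              (≤-trans (≤-catToMove G {k = k} va) cat≤1)

herder≤2⇒cut : (G : Graph n) {v a : Fin n} → Adj G v a → length (edges G) ≤ k →
               herderToMove k G v ≤ 2 → Cut G v
herder≤2⇒cut G {v} va bound herder≤2
  with j , (p , q) , e∈ , bound′ , eq ← herderToMove-attained G va bound
  with s≤s cat≤1 ← subst (_≤ 2) eq herder≤2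
  = p , q , ∈-edges⁻ G e∈ , cat≤1⇒star (G -ᵉ (p , q)) bound′ cat≤1

-- The counterpart of `cat G ≡ 2` in terms of adjacency alone: the cherry gives the lower bound, the
-- cuts the upper bound. In this form it passes through isomorphisms without comparing minimax
-- values.
TwoCuts : Graph n → Set
TwoCuts G = Cherry G × (∀ {v a} → Adj G v a → Cut G v)

module _ (G : Graph n) where

  catFrom≤cat : (v : Fin n) → catFrom G v ≤ cat G
  catFrom≤cat v = ≤-maximum-map (catFrom G) (∈-allFin v)

  cherry-or-pendant : Cherry G ⊎ (∀ v → Pendant G v)
  cherry-or-pendant
    with any? (λ v → any? (λ a → any? (λ b → adj? G v a ×-dec adj? G v b ×-dec ¬? (a Fin.≟ b))))
  ... | yes cherry = inj₁ cherry
  ... | no  none   = inj₂ λ v {x} {y} vx vy →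
    decidable-stable (x Fin.≟ y) λ x≢y → none (v , x , y , vx , vy , x≢y)

  cat≡2⇒twoCuts : cat G ≡ 2 → TwoCuts G
  cat≡2⇒twoCuts cat≡2 = cherry , λ {v} va →
    herder≤2⇒cut G va ≤-refl (≤-trans (catFrom≤cat v) (≤-reflexive cat≡2))
    where
    cherry : Cherry G
    cherry with cherry-or-pendant
    ... | inj₁ cherry  = cherry
    ... | inj₂ pendant
      with s≤s () ← subst (_≤ 1) cat≡2 (maximum-map-≤ (catFrom G) (allFin n)
                      λ {v} _ → pendant⇒herder≤1 G {k = length (edges G)} (pendant v))

  twoCuts⇒cat≡2 : TwoCuts G → cat G ≡ 2
  twoCuts⇒cat≡2 ((v , a , b , va , vb , a≢b) , cut) = ≤-antisym
    (maximum-map-≤ (catFrom G) (allFin n) λ {w} _ → catFrom≤2 w)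
    (≤-trans (2≤herder G va vb a≢b ≤-refl) (catFrom≤cat v))
    where
    catFrom≤2 : ∀ w → catFrom G w ≤ 2
    catFrom≤2 w with some-neighbour G w
    ... | inj₁ (_ , wx) = cut⇒herder≤2 {k = length (edges G)} G (cut wx)
    ... | inj₂ none     =
      ≤-trans (≤-reflexive (herderToMove-isolated G {k = length (edges G)} none)) z≤n

-- Isomorphisms

≅-reflects-twoCuts : (G : Graph m) (H : Graph n) → G ≅ H → TwoCuts H → TwoCuts G
≅-reflects-twoCuts G H (φ , hom) ((v , a , b , va , vb , a≢b) , cut) =
  (g v , g a , g b , adj⁻ va , adj⁻ vb , λ eq → a≢b (g-injective eq)) , λ va → pull-cut (cut (adj⁺ va))
  where
  open Inverse φ using (strictlyInverseˡ; strictlyInverseʳ) renaming (to to f; from to g)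

  adj⁺ : ∀ {x y} → Adj G x y → Adj H (f x) (f y)
  adj⁺ = Equivalence.to (hom _ _)

  adj⁻ : ∀ {x y} → Adj H x y → Adj G (g x) (g y)
  adj⁻ xy = Equivalence.from (hom _ _)
    (subst₂ (Adj H) (sym (strictlyInverseˡ _)) (sym (strictlyInverseˡ _)) xy)

  f-injective : ∀ {x y} → f x ≡ f y → x ≡ y
  f-injective eq = trans (sym (strictlyInverseʳ _)) (trans (cong g eq) (strictlyInverseʳ _))

  g-injective : ∀ {x y} → g x ≡ g y → x ≡ y
  g-injective eq = trans (sym (strictlyInverseˡ _)) (trans (cong f eq) (strictlyInverseˡ _))

  shift : ∀ {x p} → f x ≡ p → x ≡ g p
  shift eq = trans (sym (strictlyInverseʳ _)) (cong g eq)

  delete : ∀ {p q x y} → Adj (G -ᵉ (g p , g q)) x y → Adj (H -ᵉ (p , q)) (f x) (f y)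
  delete (xy , ¬e) = adj⁺ xy , λ where
    (inj₁ (s , t)) → ¬e (inj₁ (shift s , shift t))
    (inj₂ (s , t)) → ¬e (inj₂ (shift s , shift t))

  pull-cut : ∀ {v} → Cut H (f v) → Cut G v
  pull-cut (p , q , pq , star) =
    g p , g q , adj⁻ pq , λ va ax → f-injective (star (delete va) (delete ax))

-- A locally surjective embedding into a connected graph is surjective.
embedding⇒≅ : (G : Graph n) (H : Graph (suc m)) → Connected G →
              (xs : Vec (Fin n) (suc m)) → Unique xs →
              (∀ i j → Adj H i j → Adj G (lookup xs i) (lookup xs j)) →
              (∀ i {y} → Adj G (lookup xs i) y → ∃ λ j → lookup xs j ≡ y × Adj H i j) →
              G ≅ H
embedding⇒≅ {n} {m} G H (_ , connected) xs unique hom cover =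
  mk↔ₛ′ f (lookup xs) (λ i → injective (lookup-f (lookup xs i))) lookup-f , λ x y → mk⇔
    (λ xy → reflect (subst₂ (Adj G) (sym (lookup-f x)) (sym (lookup-f y)) xy))
    (λ xy → subst₂ (Adj G) (lookup-f x) (lookup-f y) (hom _ _ xy))
  where
  injective : ∀ {i j} → lookup xs i ≡ lookup xs j → i ≡ j
  injective = lookup-injective unique _ _

  reach : ∀ i {y} → Reachable G (lookup xs i) y → ∃ λ j → lookup xs j ≡ y
  reach i ε       = i , refl
  reach i (a ◅ p) with j , refl , _ ← cover i a = reach j p

  f : Fin n → Fin (suc m)
  f y = proj₁ (reach zero (connected _ y))

  lookup-f : ∀ y → lookup xs (f y) ≡ y
  lookup-f y = proj₂ (reach zero (connected _ y))

  -- By `cover` the embedding is also induced: the neighbour it returns is the given one by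
  -- injectivity.
  reflect : ∀ {i j} → Adj G (lookup xs i) (lookup xs j) → Adj H i j
  reflect {i} ij with k , eq , ik ← cover i ij = subst (Adj H i) (injective eq) ik

-- Pruned graphs

module _ (G : Graph n) (pruned : Pruned G) (cut : ∀ {v a} → Adj G v a → Cut G v) where

  private
    infix 4 _~_
    _~_ : Fin n → Fin n → Set
    _~_ = Adj G

    ~-sym : ∀ {x y} → x ~ y → y ~ x
    ~-sym = adj-sym G

    LeafAt : Fin n → Fin n → Set
    LeafAt v y = ∀ {x} → y ~ x → x ≡ v

    EndOf : Fin n × Fin n → Fin n → Set
    EndOf (p , q) y = y ≡ p ⊎ y ≡ q

  -- A neighbour `y` that is not an end of the deleted edge keeps all its edges, including the one
  -- to `v`. The star condition then makes `y` a leaf already in `G`.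
  end-or-leaf : ∀ {p q v y} → StarAt (G -ᵉ (p , q)) v → v ~ y → EndOf (p , q) y ⊎ LeafAt v y
  end-or-leaf {p} {q} {v} {y} star vy with y Fin.≟ p | y Fin.≟ q
  ... | yes y≡p | _       = inj₁ (inj₁ y≡p)
  ... | no  _   | yes y≡q = inj₁ (inj₂ y≡q)
  ... | no  y≢p | no  y≢q = inj₂ λ yx → star
    (vy , [ y≢q ∘ proj₂ , y≢p ∘ proj₂ ]) (yx , [ y≢p ∘ proj₁ , y≢q ∘ proj₁ ])

  ends-adjacent : ∀ {p q a b} → p ~ q → a ≢ b → EndOf (p , q) a → EndOf (p , q) b → a ~ b
  ends-adjacent pq a≢b (inj₁ refl) (inj₁ refl) = contradiction refl a≢b
  ends-adjacent pq a≢b (inj₁ refl) (inj₂ refl) = pq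
  ends-adjacent pq a≢b (inj₂ refl) (inj₁ refl) = ~-sym pq
  ends-adjacent pq a≢b (inj₂ refl) (inj₂ refl) = contradiction refl a≢b

  -- Once `a` and `b` are known to be the ends, the deleted edge can be replaced by the pair
  -- `(a , b)` when checking that other edges survive.
  ends-samePair : ∀ {p q a b x y} → a ≢ b → EndOf (p , q) a → EndOf (p , q) b →
                  SamePair (x , y) (p , q) → SamePair (x , y) (a , b)
  ends-samePair a≢b (inj₁ refl) (inj₁ refl) = contradiction refl a≢b
  ends-samePair a≢b (inj₁ refl) (inj₂ refl) = id
  ends-samePair a≢b (inj₂ refl) (inj₁ refl) = swap
  ends-samePair a≢b (inj₂ refl) (inj₂ refl) = contradiction refl a≢b

  module _ {v a b c : Fin n} (va : v ~ a) (vb : v ~ b) (vc : v ~ c)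
           (a≢b : a ≢ b) (a≢c : a ≢ c) (b≢c : b ≢ c) where

    -- The third neighbour `c` raises the degree of `v` to 3, where pruning forbids two leaves.
    no-two-leaves : LeafAt v a → LeafAt v b → ⊥
    no-two-leaves leaf-a leaf-b = proj₂ pruned
      ( a , v , b , ~-sym va , vb , a≢b
      , leaf⇒deg≡1 G (~-sym va) leaf-a , leaf⇒deg≡1 G (~-sym vb) leaf-b
      , distinct-neighbours⇒≤deg G (a ∷ b ∷ c ∷ [])
          ((a≢b ∷ a≢c ∷ []) ∷ (b≢c ∷ []) ∷ [] ∷ []) (va ∷ vb ∷ vc ∷ []) )

    -- The cut at a has to be the edge {v , b}, and the path a v c survives it.
    no-triangle : a ~ b → ⊥
    no-triangle ab with p , q , pq , star ← cut ab
      with end-or-leaf star ab | end-or-leaf star (~-sym va)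
    ... | inj₂ leaf-b | _           = adj⇒≢ G va (leaf-b (~-sym vb))
    ... | inj₁ _      | inj₂ leaf-v = a≢b (sym (leaf-v vb))
    ... | inj₁ end-b  | inj₁ end-v  = a≢c (sym (star (~-sym va , av≢pq) (vc , vc≢pq)))
      where
      to-vb : ∀ {x y} → SamePair (x , y) (p , q) → SamePair (x , y) (v , b)
      to-vb = ends-samePair (adj⇒≢ G vb) end-v end-b
      av≢pq : ¬ SamePair (a , v) (p , q)
      av≢pq e with to-vb e
      ... | inj₁ (a≡v , _) = adj⇒≢ G va (sym a≡v)
      ... | inj₂ (a≡b , _) = a≢b a≡b
      vc≢pq : ¬ SamePair (v , c) (p , q)
      vc≢pq e with to-vb e
      ... | inj₁ (_ , c≡b) = b≢c (sym c≡b)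
      ... | inj₂ (v≡b , _) = adj⇒≢ G vb v≡b

  -- By pigeonhole two of the three neighbours are of the same kind. Two ends of the cut form a
  -- triangle with `v`, and two leaves contradict pruning.
  no-three-neighbours : ∀ {v a b c} → v ~ a → v ~ b → v ~ c → a ≢ b → a ≢ c → b ≢ c → ⊥
  no-three-neighbours va vb vc a≢b a≢c b≢c with p , q , pq , star ← cut va
    with end-or-leaf star va | end-or-leaf star vb | end-or-leaf star vc
  ... | inj₁ a | inj₁ b | _      = no-triangle va vb vc a≢b a≢c b≢c (ends-adjacent pq a≢b a b)
  ... | inj₁ a | inj₂ _ | inj₁ c = no-triangle va vc vb a≢c a≢b (b≢c ∘ sym) (ends-adjacent pq a≢c a c)
  ... | inj₂ _ | inj₁ b | inj₁ c = no-triangle vb vc va b≢c (a≢b ∘ sym) (a≢c ∘ sym) (ends-adjacent pq b≢c b c)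
  ... | inj₂ a | inj₂ b | _      = no-two-leaves va vb vc a≢b a≢c b≢c a b
  ... | inj₂ a | inj₁ _ | inj₂ c = no-two-leaves va vc vb a≢c a≢b (b≢c ∘ sym) a c
  ... | inj₁ _ | inj₂ b | inj₂ c = no-two-leaves vb vc va b≢c (a≢b ∘ sym) (a≢c ∘ sym) b c

  only-two-neighbours : ∀ {v a b x} → v ~ a → v ~ b → a ≢ b → v ~ x → x ≡ a ⊎ x ≡ b
  only-two-neighbours {a = a} {b} {x} va vb a≢b vx with x Fin.≟ a | x Fin.≟ b
  ... | yes x≡a | _       = inj₁ x≡a
  ... | no  _   | yes x≡b = inj₂ x≡b
  ... | no  x≢a | no  x≢b = ⊥-elim (no-three-neighbours va vb vx a≢b (x≢a ∘ sym) (x≢b ∘ sym))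

  -- Recognising C₃, P₃ and P₄

  -- Each vertex of the triangle already has two neighbours in it, so no edge leaves the triangle,
  -- and connectedness makes it all of `G`.
  triangle⇒C₃ : ∀ {v a b} → v ~ a → v ~ b → a ~ b → G ≅ C 3
  triangle⇒C₃ {v} {a} {b} va vb ab = embedding⇒≅ G (C 3) (proj₁ pruned) (v ∷ a ∷ b ∷ [])
    ((v≢a ∷ v≢b ∷ []) ∷ (a≢b ∷ []) ∷ [] ∷ []) hom cover
    where
    v≢a = adj⇒≢ G va
    v≢b = adj⇒≢ G vb
    a≢b = adj⇒≢ G ab

    hom : ∀ i j → Adj (C 3) i j → lookup (v ∷ a ∷ b ∷ []) i ~ lookup (v ∷ a ∷ b ∷ []) j
    hom zero             (suc zero)       _  = va
    hom zero             (suc (suc zero)) _  = vb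
    hom (suc zero)       zero             _  = ~-sym va
    hom (suc zero)       (suc (suc zero)) _  = ab
    hom (suc (suc zero)) zero             _  = ~-sym vb
    hom (suc (suc zero)) (suc zero)       _  = ~-sym ab
    hom zero             zero             ii = contradiction ii (irrefl (C 3) {zero})
    hom (suc zero)       (suc zero)       ii = contradiction ii (irrefl (C 3) {suc zero})
    hom (suc (suc zero)) (suc (suc zero)) ii = contradiction ii (irrefl (C 3) {suc (suc zero)})

    cover : ∀ i {y} → lookup (v ∷ a ∷ b ∷ []) i ~ y → ∃ λ j → lookup (v ∷ a ∷ b ∷ []) j ≡ y × Adj (C 3) i j
    cover zero vy with only-two-neighbours va vb a≢b vy
    ... | inj₁ refl = suc zero , refl , inj₁ (inj₁ refl)
    -- This is the wrap-around edge of the cycle: position 0 follows position 2.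
    ... | inj₂ refl = suc (suc zero) , refl , inj₂ (inj₂ (refl , refl))
    cover (suc zero) ay with only-two-neighbours (~-sym va) ab v≢b ay
    ... | inj₁ refl = zero , refl , inj₂ (inj₁ refl)
    ... | inj₂ refl = suc (suc zero) , refl , inj₁ (inj₁ refl)
    cover (suc (suc zero)) by with only-two-neighbours (~-sym vb) (~-sym ab) v≢a by
    ... | inj₁ refl = zero , refl , inj₁ (inj₂ (refl , refl))
    ... | inj₂ refl = suc zero , refl , inj₂ (inj₁ refl)

  -- In the order `b`, `v`, `a` the leaf conditions close the two ends, and the degree bound closes
  -- the middle.
  path⇒P₃ : ∀ {b v a} → v ~ a → v ~ b → a ≢ b → LeafAt v b → LeafAt v a → G ≅ P 3
  path⇒P₃ {b} {v} {a} va vb a≢b leaf-b leaf-a =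
    embedding⇒≅ G (P 3) (proj₁ pruned) (b ∷ v ∷ a ∷ [])
      (((adj⇒≢ G vb ∘ sym) ∷ (a≢b ∘ sym) ∷ []) ∷ (adj⇒≢ G va ∷ []) ∷ [] ∷ [])
      (λ { i j (inj₁ ij) → step i j ij ; i j (inj₂ ji) → ~-sym (step j i ji) }) cover
    where
    step : ∀ i j → suc (toℕ i) ≡ toℕ j → lookup (b ∷ v ∷ a ∷ []) i ~ lookup (b ∷ v ∷ a ∷ []) j
    step zero       (suc zero)       refl = ~-sym vb
    step (suc zero) (suc (suc zero)) refl = va

    cover : ∀ i {y} → lookup (b ∷ v ∷ a ∷ []) i ~ y → ∃ λ j → lookup (b ∷ v ∷ a ∷ []) j ≡ y × Adj (P 3) i j
    cover zero by with refl ← leaf-b by = suc zero , refl , inj₁ refl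
    cover (suc zero) vy with only-two-neighbours va vb a≢b vy
    ... | inj₁ refl = suc (suc zero) , refl , inj₁ refl
    ... | inj₂ refl = zero , refl , inj₂ refl
    cover (suc (suc zero)) ay with refl ← leaf-a ay = suc zero , refl , inj₂ refl

  path⇒P₄ : ∀ {b v a c} → v ~ a → v ~ b → a ~ c → a ≢ b → v ≢ c →
            LeafAt v b → LeafAt a c → G ≅ P 4
  path⇒P₄ {b} {v} {a} {c} va vb ac a≢b v≢c leaf-b leaf-c =
    embedding⇒≅ G (P 4) (proj₁ pruned) (b ∷ v ∷ a ∷ c ∷ [])
      (((adj⇒≢ G vb ∘ sym) ∷ (a≢b ∘ sym) ∷ b≢c ∷ []) ∷ (adj⇒≢ G va ∷ v≢c ∷ []) ∷ (adj⇒≢ G ac ∷ []) ∷ [] ∷ [])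
      (λ { i j (inj₁ ij) → step i j ij ; i j (inj₂ ji) → ~-sym (step j i ji) }) cover
    where
    b≢c : b ≢ c
    -- A common leaf of `v` and `a` would force `v ≡ a`.
    b≢c refl = adj⇒≢ G va (leaf-c (~-sym vb))

    step : ∀ i j → suc (toℕ i) ≡ toℕ j → lookup (b ∷ v ∷ a ∷ c ∷ []) i ~ lookup (b ∷ v ∷ a ∷ c ∷ []) j
    step zero             (suc zero)             refl = ~-sym vb
    step (suc zero)       (suc (suc zero))       refl = va
    step (suc (suc zero)) (suc (suc (suc zero))) refl = ac

    cover : ∀ i {y} → lookup (b ∷ v ∷ a ∷ c ∷ []) i ~ y →
            ∃ λ j → lookup (b ∷ v ∷ a ∷ c ∷ []) j ≡ y × Adj (P 4) i j
    cover zero by with refl ← leaf-b by = suc zero , refl , inj₁ refl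
    cover (suc zero) vy with only-two-neighbours va vb a≢b vy
    ... | inj₁ refl = suc (suc zero) , refl , inj₁ refl
    ... | inj₂ refl = zero , refl , inj₂ refl
    cover (suc (suc zero)) ay with only-two-neighbours (~-sym va) ac v≢c ay
    ... | inj₁ refl = suc zero , refl , inj₂ refl
    ... | inj₂ refl = suc (suc (suc zero)) , refl , inj₁ refl
    cover (suc (suc (suc zero))) cy with refl ← leaf-c cy = suc (suc zero) , refl , inj₂ refl

  -- Starting from the leaf `b`, the path continues through `v` to `a`. It either stops there or has
  -- a next vertex `c`, and then the cut at `a` shows that it stops at `c`.
  leaf⇒path : ∀ {b v a} → v ~ a → v ~ b → a ≢ b → LeafAt v b → G ≅ P 3 ⊎ G ≅ P 4
  leaf⇒path {b} {v} {a} va vb a≢b leaf-b with any? (λ c → adj? G a c ×-dec ¬? (c Fin.≟ v))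
  ... | no none = inj₁ (path⇒P₃ va vb a≢b leaf-b λ {x} ax →
        decidable-stable (x Fin.≟ v) λ x≢v → none (x , ax , x≢v))
  ... | yes (c , ac , c≢v) with p , q , pq , star ← cut ac
    with end-or-leaf star (~-sym va) | end-or-leaf star ac
  -- `v` is not a leaf at `a`, because it is also adjacent to `b`; so it is an end of the cut.
  ...   | inj₂ leaf-v | _           = contradiction (sym (leaf-v vb)) a≢b
  ...   | inj₁ _      | inj₂ leaf-c = inj₂ (path⇒P₄ va vb ac a≢b (c≢v ∘ sym) leaf-b leaf-c)
  ...   | inj₁ end-v  | inj₁ end-c
    -- If `c` is the other end, it is adjacent to `v`, hence equal to `a` or `b`. But `a` is not its
    -- own neighbour, and the leaf `b` is not adjacent to `a`.
    with only-two-neighbours va vb a≢b (ends-adjacent pq (c≢v ∘ sym) end-v end-c)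
  ...     | inj₁ refl = contradiction ac (irrefl G)
  ...     | inj₂ refl = contradiction (sym (leaf-b (~-sym ac))) (adj⇒≢ G va)

  cherry⇒C₃-or-path : Cherry G → G ≅ C 3 ⊎ G ≅ P 3 ⊎ G ≅ P 4
  cherry⇒C₃-or-path (v , a , b , va , vb , a≢b) with p , q , pq , star ← cut va
    with end-or-leaf star va | end-or-leaf star vb
  ... | inj₁ end-a  | inj₁ end-b  = inj₁ (triangle⇒C₃ va vb (ends-adjacent pq a≢b end-a end-b))
  ... | _           | inj₂ leaf-b = inj₂ (leaf⇒path va vb a≢b leaf-b)
  ... | inj₂ leaf-a | inj₁ _      = inj₂ (leaf⇒path vb va (a≢b ∘ sym) leaf-a)

mainTheorem6 : (n : ℕ) (G : Graph n) → Pruned G →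
    cat G ≡ 2 ⇔ (G ≅ C 3 ⊎ G ≅ P 3 ⊎ G ≅ P 4)
mainTheorem6 n G pruned = mk⇔ classify
  -- Each `refl` evaluates the whole game on one of the three concrete graphs.
  [ evaluate (C 3) refl , [ evaluate (P 3) refl , evaluate (P 4) refl ] ]
  where
  classify : cat G ≡ 2 → G ≅ C 3 ⊎ G ≅ P 3 ⊎ G ≅ P 4
  classify cat≡2 with cherry , cut ← cat≡2⇒twoCuts G cat≡2 = cherry⇒C₃-or-path G pruned cut cherry

  -- The computed value is turned into `TwoCuts H`, pulled back to `G`, and turned into a value
  -- again.
  evaluate : (H : Graph m) → cat H ≡ 2 → G ≅ H → cat G ≡ 2
  evaluate H cat≡2 iso = twoCuts⇒cat≡2 G (≅-reflects-twoCuts G H iso (cat≡2⇒twoCuts H cat≡2))
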